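{- Let $k, m$ be positive integers. Every finite simple $k$-connected bipartite graph $G$ with minimum degree $\delta(G)\ge k+m$ contains a path $P$ of order $m$ such that $G-V(P)$ is $k$-connected.
   Context: All graphs are finite and simple. The order of a graph is its number of vertices; a path of order $m$ is a path with exactly $m$ vertices (a path of order $1$ is a single vertex). Paths are subgraphs, not necessarily induced. The connectivity $\kappa(G)$ is the minimum size of a vertex set $S$ such that $G-S$ is disconnected or has only one vertex; $G$ is $k$-connected if $\kappa(G)\ge k$. For $U\subseteq V(G)$, $G-U$ is the induced subgraph on $V(G)\setminus U$. -}

module Defs where

open import Data.Fin.Base using (Fin)
open import Data.Fin.Subset using (Subset; _∈_; _∉_; _⊆_; _∪_; _∩_; _─_; ⊥; ⁅_⁆; ⋃; ∣_∣)
open import Data.Fin.Subset.Properties using (_∈?_; x∈p∧x∉q⇒x∈p─q)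
open import Data.Nat.Base using (ℕ; _≤_)
open import Data.Product.Base using (∃; ∃₂; _×_; _,_)
open import Data.Sum.Base using (_⊎_)
open import Data.Vec.Base using (Vec; tabulate; toList)
open import Data.Vec.Relation.Unary.All using (All)
open import Data.Vec.Relation.Unary.Linked using (Linked)
open import Data.Vec.Relation.Unary.Unique.Propositional using (Unique)
import Data.List.Base as List
open import Relation.Binary.Construct.Closure.ReflexiveTransitive using (Star)
open import Relation.Binary.Definitions using (Decidable; Symmetric; Irreflexive)
open import Relation.Binary.PropositionalEquality.Core using (_≡_)
open import Relation.Nullary.Decidable.Core using (does; _×-dec_; ¬?)
open import Relation.Nullary.Negation.Core using (¬_)

-- A finite simple graph whose vertices are drawn from the label set Fin N.
-- The vertex set is an arbitrary subset of the labels, so that deleting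
-- vertices yields a graph over the same labels; the order of G is ∣ V ∣, not N.
record Graph (N : ℕ) : Set₁ where
  infix 4 _~_ _~?_
  field
    V      : Subset N
    _~_    : Fin N → Fin N → Set
    _~?_   : Decidable _~_
    sym    : Symmetric _~_
    irrefl : Irreflexive _≡_ _~_
    inV    : ∀ {u v} → u ~ v → u ∈ V

open Graph public using (V)

private
  variable
    N : ℕ

infixl 5 _∖_

_∖_ : Graph N → Subset N → Graph N
G ∖ U = record
  { V      = V G ─ U
  ; _~_    = λ u v → u ~ v × u ∉ U × v ∉ U
  ; _~?_   = λ u v → (u ~? v) ×-dec (¬? (u ∈? U) ×-dec ¬? (v ∈? U))
  ; sym    = λ (e , u∉U , v∉U) → sym e , v∉U , u∉U
  ; irrefl = λ u≡v (e , _) → irrefl u≡v e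
  ; inV    = λ (e , u∉U , _) → x∈p∧x∉q⇒x∈p─q (inV e) u∉U
  }
  where open Graph G using (_~_; _~?_; sym; irrefl; inV)

IsMinimum : (ℕ → Set) → ℕ → Set
IsMinimum P a = P a × (∀ {b} → P b → a ≤ b)

neighbours : Graph N → Fin N → Subset N
neighbours G v = tabulate (λ u → does (v ~? u))
  where open Graph G using (_~?_)

degree : Graph N → Fin N → ℕ
degree G v = ∣ neighbours G v ∣

IsMinDegree : Graph N → ℕ → Set
IsMinDegree G = IsMinimum (λ d → ∃ λ v → v ∈ V G × degree G v ≡ d)

-- δ(G) ≥ d.  The graph without vertices has no minimum degree.
MinDegree≥ : Graph N → ℕ → Set
MinDegree≥ G d = ∃ λ δ → IsMinDegree G δ × d ≤ δ

Bipartite : Graph N → Set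
Bipartite G = ∃₂ λ X Y →
  X ∪ Y ≡ V G × X ∩ Y ≡ ⊥ ×
  (∀ {u v} → u ~ v → (u ∈ X × v ∈ Y) ⊎ (u ∈ Y × v ∈ X))
  where open Graph G using (_~_)

Connected : Graph N → Set
Connected G = ∀ {u v} → u ∈ V G → v ∈ V G → Star _~_ u v
  where open Graph G using (_~_)

DisconnectedOrTrivial : Graph N → Set
DisconnectedOrTrivial G = ¬ Connected G ⊎ ∣ V G ∣ ≡ 1

IsConnectivity : Graph N → ℕ → Set
IsConnectivity G = IsMinimum λ s →
  ∃ λ S → S ⊆ V G × DisconnectedOrTrivial (G ∖ S) × ∣ S ∣ ≡ s

-- κ(G) ≥ k.  The graph without vertices has no connectivity, as no S qualifies,
-- and hence is not k-connected for any k.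
KConnected : ℕ → Graph N → Set
KConnected k G = ∃ λ κ → IsConnectivity G κ × k ≤ κ

-- A path of order m, given by the sequence of its m vertices.  Membership in
-- V G has to be demanded because a path of order 1 has no edges.
record Path (G : Graph N) (m : ℕ) : Set where
  open Graph G using (_~_)
  field
    vertices : Vec (Fin N) m
    inside   : All (_∈ V G) vertices
    distinct : Unique vertices
    linked   : Linked _~_ vertices

vertexSet : ∀ {G : Graph N} {m} → Path G m → Subset N
vertexSet P = ⋃ (List.map ⁅_⁆ (toList (Path.vertices P)))

{-# OPTIONS --safe #-}

-- A fragment of a vertex set W with k-connected G[W] is one side A of a
-- separation (A, T, B) of W with |T| ≤ k.  While a path P has order j < m, every
-- vertex has more than k neighbours outside P, and since G has no triangles
-- every fragment of G − P has more than k vertices.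
--
-- Extend P greedily as long as the rest stays k-connected.  Once that fails,
-- G − P has a fragment A, and we descend on |A|.  If the end vertex of P has no
-- neighbour in A, it can be dropped from P: it joins the side B, and putting it
-- back keeps the rest k-connected because it has at least k neighbours there.
-- Otherwise (or if P is empty) P extends to some x ∈ A.  If G − P − x is
-- k-connected, A − x is a fragment of it.  If not, x lies in another k-separator
-- of G − P; as all four sides are larger than k, two opposite corners of the
-- crossing separations are nonempty, and by submodularity one of them is a
-- fragment inside A that misses x.
module Submission where

open import Defs
open import Data.Nat.Base using (ℕ; _+_; _≤_)
open import Data.Product.Base using (∃)

open import Data.Bool.Base using (true)
import Data.Empty as Empty
open import Data.Empty using (⊥-elim)
open import Data.Fin.Base using (Fin)
open import Data.Fin.Properties using (any?; all?)
open import Data.Fin.Subset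
  using ( Subset; inside; outside; _∈_; _∉_; _⊆_; _∪_; _∩_; _─_; _-_; ⊥; ⁅_⁆; ⋃; ∣_∣; Nonempty
        ; Empty )
open import Data.Fin.Subset.Properties
  using ( _∈?_; _⊆?_; nonempty?; anySubset?; x∈p∪q⁺; x∈p∪q⁻; x∈p∩q⁺; x∈p∩q⁻; p─q⊆p; x∈p∧x∉q⇒x∈p─q
        ; x∈⁅x⁆; x∈⁅y⁆⇒x≡y; ∣⁅x⁆∣≡1; p⊆q⇒∣p∣≤∣q∣; x∈p⇒∣p-x∣<∣p∣; x∈p∧x≢y⇒x∈p-y; ∉⊥; ∣⊥∣≡0
        ; Empty-unique; p⊂q⇒∣p∣<∣q∣; ∣p∣≤n; p─⊥≡p; ⊆-antisym; ∪-comm; ∩-comm )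
import Data.List.Base as List
open import Data.Nat.Base using (zero; suc; _<_; z≤n; s≤s; s≤s⁻¹; _∸_)
open import Data.Nat.Induction using (Acc; acc; <-wellFounded)
open import Data.Nat.Properties
  using ( module ≤-Reasoning; ≤-refl; ≤-reflexive; ≤-trans; <-≤-trans; ≤-<-trans; <⇒≤; <⇒≱; ≮⇒≥
        ; _<?_; _≟_; m≤m+n; m≤n+m; +-comm; +-suc; +-identityʳ; +-mono-≤; +-monoʳ-≤; +-cancelʳ-≤
        ; m≤n⇒m<n∨m≡n; ∸-monoʳ-< )
open import Data.Product.Base using (∃₂; _×_; _,_; proj₁; proj₂)
open import Data.Sum.Base using (_⊎_; inj₁; inj₂; [_,_]′)
open import Data.Vec.Base using (Vec; []; _∷_; here; there; toList)
open import Data.Vec.Properties using ([]=⇒lookup; lookup∘tabulate)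
open import Data.Vec.Relation.Unary.All using (All; []; _∷_)
open import Data.Vec.Relation.Unary.AllPairs using ([]; _∷_)
open import Data.Vec.Relation.Unary.Linked as Linked using (Linked; []; [-]; _∷_)
open import Function.Base using (_∘_; id; case_of_)
open import Relation.Binary.Construct.Closure.ReflexiveTransitive using (Star; ε; _◅_; _◅◅_; reverse)
open import Relation.Binary.PropositionalEquality using (_≡_; _≢_; refl; sym; trans; cong; subst)
open import Relation.Nullary.Decidable using (Dec; yes; no; does; map′; _×-dec_; _→-dec_; ¬?)
open import Relation.Nullary.Negation using (¬_; contradiction)
open import Relation.Unary using (Decidable)

-- Cardinalities of finite sets and least numbers.

x∈p─q⇒x∉q : ∀ {n} {x : Fin n} (p q : Subset n) → x ∈ p ─ q → x ∉ q
x∈p─q⇒x∉q (_ ∷ p) (_ ∷ q) (there x∈) (there x∈q) = x∈p─q⇒x∉q p q x∈ x∈q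
x∈p─q⇒x∉q (_ ∷ p) (inside ∷ q) () here

∣p∪q∣+∣p∩q∣≡∣p∣+∣q∣ : ∀ {n} (p q : Subset n) → ∣ p ∪ q ∣ + ∣ p ∩ q ∣ ≡ ∣ p ∣ + ∣ q ∣
∣p∪q∣+∣p∩q∣≡∣p∣+∣q∣ []            []            = refl
∣p∪q∣+∣p∩q∣≡∣p∣+∣q∣ (outside ∷ p) (outside ∷ q) = ∣p∪q∣+∣p∩q∣≡∣p∣+∣q∣ p q
∣p∪q∣+∣p∩q∣≡∣p∣+∣q∣ (inside  ∷ p) (outside ∷ q) = cong suc (∣p∪q∣+∣p∩q∣≡∣p∣+∣q∣ p q)
∣p∪q∣+∣p∩q∣≡∣p∣+∣q∣ (outside ∷ p) (inside  ∷ q) =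
  trans (cong suc (∣p∪q∣+∣p∩q∣≡∣p∣+∣q∣ p q)) (sym (+-suc ∣ p ∣ ∣ q ∣))
∣p∪q∣+∣p∩q∣≡∣p∣+∣q∣ (inside  ∷ p) (inside  ∷ q) = cong suc
  (trans (+-suc ∣ p ∪ q ∣ ∣ p ∩ q ∣) (trans (cong suc (∣p∪q∣+∣p∩q∣≡∣p∣+∣q∣ p q)) (sym (+-suc ∣ p ∣ ∣ q ∣))))

∣p∪q∣≤∣p∣+∣q∣ : ∀ {n} (p q : Subset n) → ∣ p ∪ q ∣ ≤ ∣ p ∣ + ∣ q ∣
∣p∪q∣≤∣p∣+∣q∣ p q = ≤-trans (m≤m+n _ _) (≤-reflexive (∣p∪q∣+∣p∩q∣≡∣p∣+∣q∣ p q))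

module _ {n : ℕ} {p q : Subset n} where

  ∣p∣≤∣p─q∣+∣q∣ : ∣ p ∣ ≤ ∣ p ─ q ∣ + ∣ q ∣
  ∣p∣≤∣p─q∣+∣q∣ = ≤-trans (p⊆q⇒∣p∣≤∣q∣ split) (∣p∪q∣≤∣p∣+∣q∣ (p ─ q) q)
    where
    split : p ⊆ (p ─ q) ∪ q
    split {x} x∈p with x ∈? q
    ... | yes x∈q = x∈p∪q⁺ (inj₂ x∈q)
    ... | no  x∉q = x∈p∪q⁺ (inj₁ (x∈p∧x∉q⇒x∈p─q x∈p x∉q))

  -- By inclusion-exclusion both sums split into union plus intersection, so two inclusions suffice.
  -- Both submodularity and the count of two neighbourhoods take this form.
  ∣p∣+∣q∣≤ : ∀ {r s} → p ∪ q ⊆ r ∪ s → p ∩ q ⊆ r ∩ s → ∣ p ∣ + ∣ q ∣ ≤ ∣ r ∣ + ∣ s ∣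
  ∣p∣+∣q∣≤ {r} {s} ∪⊆ ∩⊆ = begin
    ∣ p ∣ + ∣ q ∣          ≡⟨ ∣p∪q∣+∣p∩q∣≡∣p∣+∣q∣ p q ⟨
    ∣ p ∪ q ∣ + ∣ p ∩ q ∣  ≤⟨ +-mono-≤ (p⊆q⇒∣p∣≤∣q∣ ∪⊆) (p⊆q⇒∣p∣≤∣q∣ ∩⊆) ⟩
    ∣ r ∪ s ∣ + ∣ r ∩ s ∣  ≡⟨ ∣p∪q∣+∣p∩q∣≡∣p∣+∣q∣ r s ⟩
    ∣ r ∣ + ∣ s ∣          ∎
    where open ≤-Reasoning

∣⁅x⁆∪p∣≤1+∣p∣ : ∀ {n} (x : Fin n) (p : Subset n) → ∣ ⁅ x ⁆ ∪ p ∣ ≤ suc ∣ p ∣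
∣⁅x⁆∪p∣≤1+∣p∣ x p = ≤-trans (∣p∪q∣≤∣p∣+∣q∣ ⁅ x ⁆ p) (≤-reflexive (cong (_+ ∣ p ∣) (∣⁅x⁆∣≡1 x)))

0<∣p∣⇒Nonempty : ∀ {n} {p : Subset n} → 0 < ∣ p ∣ → Nonempty p
0<∣p∣⇒Nonempty {n} {p} 0<p with nonempty? p
... | yes ne = ne
... | no  em = contradiction (≤-reflexive (trans (cong ∣_∣ (Empty-unique em)) (∣⊥∣≡0 n))) (<⇒≱ 0<p)

-- `KConnected` asks for an actual value of the connectivity, so a least separator size has to be
-- found by search; the known witness `n` bounds it.
minimum : ∀ {P : ℕ → Set} → Decidable P → ∀ {n} → P n → ∃ (IsMinimum P)
minimum {P} P? {n} Pn = [ id , (λ none → contradiction Pn (none ≤-refl)) ]′ (search (suc n))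
  where
  search : ∀ l → ∃ (IsMinimum P) ⊎ (∀ {b} → b < l → ¬ P b)
  search zero = inj₂ λ ()
  search (suc l) with search l
  ... | inj₁ found = inj₁ found
  ... | inj₂ none with P? l
  ...   | yes Pl = inj₁ (l , Pl , λ Pb → ≮⇒≥ λ b<l → none b<l Pb)
  ...   | no ¬Pl = inj₂ λ b<1+l Pb → case m≤n⇒m<n∨m≡n (s≤s⁻¹ b<1+l) of λ where
    (inj₁ b<l)  → none b<l Pb
    (inj₂ refl) → ¬Pl Pb

-- Separations and robust vertex sets.

-- The separator T of a separation (A, T, B) of W.
boundary : ∀ {n} (W A B : Subset n) → Subset n
boundary W A B = W ─ (A ∪ B)

module _ {n : ℕ} {W A B : Subset n} {x : Fin n} where

  boundary⁺ : x ∈ W → x ∉ A → x ∉ B → x ∈ boundary W A B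
  boundary⁺ x∈W x∉A x∉B = x∈p∧x∉q⇒x∈p─q x∈W ([ x∉A , x∉B ]′ ∘ x∈p∪q⁻ A B)

  boundary⁻ : x ∈ boundary W A B → x ∈ W × x ∉ A × x ∉ B
  boundary⁻ x∈T = p─q⊆p W (A ∪ B) x∈T ,
    x∈p─q⇒x∉q W (A ∪ B) x∈T ∘ x∈p∪q⁺ ∘ inj₁ , x∈p─q⇒x∉q W (A ∪ B) x∈T ∘ x∈p∪q⁺ ∘ inj₂

-- The graph stays fixed and only `W` varies, so deleting path vertices or putting them back leaves
-- adjacency untouched.
record Separation {N : ℕ} (G : Graph N) (W A B : Subset N) : Set where
  open Graph G using (_~_)
  field
    left⊆W   : A ⊆ W
    right⊆W  : B ⊆ W
    left≠∅   : Nonempty A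
    right≠∅  : Nonempty B
    disjoint : ∀ {x} → x ∈ A → x ∉ B
    noEdge   : ∀ {x y} → x ∈ A → y ∈ B → ¬ x ~ y

open Separation

-- For `W = V G` this is equivalent to `KConnected k G`, but stated without deletions or
-- reachability.
record Robust {N : ℕ} (G : Graph N) (k : ℕ) (W : Subset N) : Set where
  field
    order>k    : k < ∣ W ∣
    boundary≥k : ∀ {A B} → Separation G W A B → k ≤ ∣ boundary W A B ∣

open Robust

module _ {N : ℕ} {G : Graph N} where
  open Graph G using (_~_; _~?_) renaming (sym to ~-sym)

  swap : ∀ {W A B} → Separation G W A B → Separation G W B A
  swap σ = record
    { left⊆W = right⊆W σ ; right⊆W = left⊆W σ ; left≠∅ = right≠∅ σ ; right≠∅ = left≠∅ σ
    ; disjoint = λ x∈B x∈A → disjoint σ x∈A x∈B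
    ; noEdge = λ x∈B y∈A x~y → noEdge σ y∈A x∈B (~-sym x~y) }

  separation? : ∀ W A B → Dec (Separation G W A B)
  separation? W A B = map′
    {A = A ⊆ W × B ⊆ W × Nonempty A × Nonempty B × (∀ x → x ∈ A → x ∉ B) ×
         (∀ x y → x ∈ A → y ∈ B → ¬ x ~ y)}
    (λ (A⊆W , B⊆W , A≠∅ , B≠∅ , disj , none) → record
      { left⊆W = λ {_} → A⊆W ; right⊆W = λ {_} → B⊆W ; left≠∅ = A≠∅ ; right≠∅ = B≠∅
      ; disjoint = disj _ ; noEdge = none _ _ })
    (λ σ → (λ {_} → left⊆W σ) , (λ {_} → right⊆W σ) , left≠∅ σ , right≠∅ σ ,
           (λ _ → disjoint σ) , (λ _ _ → noEdge σ))
    (A ⊆? W ×-dec B ⊆? W ×-dec nonempty? A ×-dec nonempty? B ×-dec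
     all? (λ x → x ∈? A →-dec ¬? (x ∈? B)) ×-dec
     all? (λ x → all? λ y → x ∈? A →-dec (y ∈? B →-dec ¬? (x ~? y))))

  -- All pairs of subsets can be searched, so a failure of robustness comes with an explicit small
  -- separation.
  robust⊎separated : ∀ {k W} → k < ∣ W ∣ →
    Robust G k W ⊎ (∃₂ λ A B → Separation G W A B × ∣ boundary W A B ∣ < k)
  robust⊎separated {k} {W} k<W
    with anySubset? (λ A → anySubset? λ B → separation? W A B ×-dec ∣ boundary W A B ∣ <? k)
  ... | yes small = inj₂ small
  ... | no ¬small = inj₁ record
    { order>k = k<W ; boundary≥k = λ σ → ≮⇒≥ λ <k → ¬small (_ , _ , σ , <k) }

  -- Since `W` avoids `S`, every edge of `G` inside `W` survives in `G ∖ S`; hence no edge between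
  -- the sides is hidden by the deletion.
  undelete : ∀ {S W W′ A B} → W ⊆ V (G ∖ S) → W ⊆ W′ → Separation (G ∖ S) W A B → Separation G W′ A B
  undelete {S} W⊆ W⊆W′ σ = record
    { left⊆W = W⊆W′ ∘ left⊆W σ ; right⊆W = W⊆W′ ∘ right⊆W σ ; left≠∅ = left≠∅ σ ; right≠∅ = right≠∅ σ
    ; disjoint = disjoint σ
    ; noEdge = λ x∈A y∈B x~y → noEdge σ x∈A y∈B
        (x~y , x∈p─q⇒x∉q (V G) S (W⊆ (left⊆W σ x∈A)) , x∈p─q⇒x∉q (V G) S (W⊆ (right⊆W σ y∈B))) }

  -- Components and decidability of connectedness.

  star-closed : ∀ {A : Subset N} → (∀ {x y} → x ∈ A → x ~ y → y ∈ A) →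
    ∀ {x y} → x ∈ A → Star _~_ x y → y ∈ A
  star-closed closed x∈A ε          = x∈A
  star-closed closed x∈A (x~z ◅ zy) = star-closed closed (closed x∈A x~z) zy

  -- Starting from `⁅ u ⁆`, add the far end of an edge leaving `A` until none is left. Each round
  -- enlarges `A`, whose size is at most `N`.
  component : ∀ u → ∃ λ A → u ∈ A × (∀ {x} → x ∈ A → Star _~_ u x) × (∀ {x y} → x ∈ A → x ~ y → y ∈ A)
  component u = grow ⁅ u ⁆ (x∈⁅x⁆ u) (λ x∈ → subst (Star _~_ u) (sym (x∈⁅y⁆⇒x≡y u x∈)) ε) (<-wellFounded _)
    where
    grow : ∀ A → u ∈ A → (∀ {x} → x ∈ A → Star _~_ u x) → Acc _<_ (N ∸ ∣ A ∣) →
      ∃ λ A → u ∈ A × (∀ {x} → x ∈ A → Star _~_ u x) × (∀ {x y} → x ∈ A → x ~ y → y ∈ A)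
    grow A u∈A reach (acc rec) with any? (λ x → any? λ y → x ∈? A ×-dec (x ~? y ×-dec ¬? (y ∈? A)))
    ... | no closed = A , u∈A , reach , closed′
      where
      closed′ : ∀ {x y} → x ∈ A → x ~ y → y ∈ A
      closed′ {x} {y} x∈A x~y with y ∈? A
      ... | yes y∈A = y∈A
      ... | no  y∉A = contradiction (x , y , x∈A , x~y , y∉A) closed
    ... | yes (x , y , x∈A , x~y , y∉A) = grow (⁅ y ⁆ ∪ A) (x∈p∪q⁺ (inj₂ u∈A)) reach′
      (rec (∸-monoʳ-< (p⊂q⇒∣p∣<∣q∣ (x∈p∪q⁺ ∘ inj₂ , y , x∈p∪q⁺ (inj₁ (x∈⁅x⁆ y)) , y∉A)) (∣p∣≤n (⁅ y ⁆ ∪ A))))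
      where
      reach′ : ∀ {z} → z ∈ ⁅ y ⁆ ∪ A → Star _~_ u z
      reach′ z∈ with x∈p∪q⁻ ⁅ y ⁆ A z∈
      ... | inj₂ z∈A = reach z∈A
      ... | inj₁ z∈y = subst (Star _~_ u) (sym (x∈⁅y⁆⇒x≡y y z∈y)) (reach x∈A ◅◅ (x~y ◅ ε))

  -- A separation with empty boundary: the witness that `¬ Connected G` by itself does not provide.
  Cut : Set
  Cut = ∃₂ λ A B → Separation G (V G) A B × V G ⊆ A ∪ B

  cut⇒¬connected : Cut → ¬ Connected G
  cut⇒¬connected (A , B , σ , cover) conn with left≠∅ σ | right≠∅ σ
  ... | a , a∈A | b , b∈B =
    disjoint σ (star-closed closed a∈A (conn (left⊆W σ a∈A) (right⊆W σ b∈B))) b∈B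
    where
    closed : ∀ {x y} → x ∈ A → x ~ y → y ∈ A
    closed x∈A x~y with x∈p∪q⁻ A B (cover (Graph.inV G (~-sym x~y)))
    ... | inj₁ y∈A = y∈A
    ... | inj₂ y∈B = contradiction x~y (noEdge σ x∈A y∈B)

  connected⊎cut : Connected G ⊎ Cut
  connected⊎cut with nonempty? (V G)
  ... | no empty = inj₁ λ u∈V → contradiction (_ , u∈V) empty
  ... | yes (w , w∈V) with component w
  ...   | A , w∈A , reach , closed with nonempty? (V G ─ A)
  -- `component` does not record that `A` lies in `V G`, hence the intersection.
  ...     | yes ne = inj₂ (A ∩ V G , V G ─ A , σ , cover)
    where
    σ : Separation G (V G) (A ∩ V G) (V G ─ A)
    σ = record
      { left⊆W = proj₂ ∘ x∈p∩q⁻ A (V G) ; right⊆W = p─q⊆p (V G) A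
      ; left≠∅ = w , x∈p∩q⁺ (w∈A , w∈V) ; right≠∅ = ne
      ; disjoint = λ x∈ x∈′ → x∈p─q⇒x∉q (V G) A x∈′ (proj₁ (x∈p∩q⁻ A (V G) x∈))
      ; noEdge = λ x∈ y∈ x~y → x∈p─q⇒x∉q (V G) A y∈ (closed (proj₁ (x∈p∩q⁻ A (V G) x∈)) x~y) }
    cover : V G ⊆ (A ∩ V G) ∪ (V G ─ A)
    cover {x} x∈V with x ∈? A
    ... | yes x∈A = x∈p∪q⁺ (inj₁ (x∈p∩q⁺ (x∈A , x∈V)))
    ... | no  x∉A = x∈p∪q⁺ (inj₂ (x∈p∧x∉q⇒x∈p─q x∈V x∉A))
  ...     | no em = inj₁ λ u∈V v∈V → reverse ~-sym (from u∈V) ◅◅ from v∈V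
    where
    from : ∀ {x} → x ∈ V G → Star _~_ w x
    from {x} x∈V with x ∈? A
    ... | yes x∈A = reach x∈A
    ... | no  x∉A = contradiction (x , x∈p∧x∉q⇒x∈p─q x∈V x∉A) em

  disconnectedOrTrivial? : Dec (DisconnectedOrTrivial G)
  disconnectedOrTrivial? with connected⊎cut
  ... | inj₂ cut  = yes (inj₁ (cut⇒¬connected cut))
  ... | inj₁ conn = map′ inj₂ [ contradiction (λ {u} {v} → conn {u} {v}) , id ]′ (∣ V G ∣ ≟ 1)

-- Robustness of the whole vertex set and k-connectivity.

module _ {N : ℕ} {G : Graph N} {k : ℕ} where

  -- If one vertex is left, the bound on the order gives the claim. If `G ∖ S` is disconnected, a
  -- cut of it is a separation of `V G` whose boundary lies in `S`.
  disconnecting-large : Robust G k (V G) → ∀ {S} → DisconnectedOrTrivial (G ∖ S) → k ≤ ∣ S ∣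
  disconnecting-large ρ {S} (inj₂ V─S≡1) = s≤s⁻¹ (≤-trans (order>k ρ)
    (≤-trans (∣p∣≤∣p─q∣+∣q∣ {p = V G} {S}) (≤-reflexive (cong (_+ ∣ S ∣) V─S≡1))))
  disconnecting-large ρ {S} (inj₁ ¬conn) with connected⊎cut {G = G ∖ S}
  ... | inj₁ conn = contradiction (λ {u} {v} → conn {u} {v}) ¬conn
  ... | inj₂ (A , B , σ , cover) =
    ≤-trans (boundary≥k ρ (undelete id (p─q⊆p (V G) S) σ)) (p⊆q⇒∣p∣≤∣q∣ boundary⊆S)
    where
    boundary⊆S : boundary (V G) A B ⊆ S
    boundary⊆S {x} x∈T with x ∈? S
    ... | yes x∈S = x∈S
    ... | no  x∉S with boundary⁻ {A = A} {B} x∈T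
    ...   | x∈V , x∉A , x∉B = contradiction (x∈p∪q⁻ A B (cover (x∈p∧x∉q⇒x∈p─q x∈V x∉S))) [ x∉A , x∉B ]′

  robust⇒KConnected : Robust G k (V G) → KConnected k G
  robust⇒KConnected ρ = κ , isMin , k≤κ
    where
    Disconnects : ℕ → Set
    Disconnects s = ∃ λ S → S ⊆ V G × DisconnectedOrTrivial (G ∖ S) × ∣ S ∣ ≡ s

    w : Nonempty (V G)
    w = 0<∣p∣⇒Nonempty (≤-<-trans z≤n (order>k ρ))

    -- A minimum exists only if some set qualifies: delete all vertices except one.
    allButOne : ∃ Disconnects
    allButOne = _ , V G - proj₁ w , p─q⊆p (V G) _ , trivial , refl
      where
      x = proj₁ w

      single : V (G ∖ (V G - x)) ≡ ⁅ x ⁆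
      single = ⊆-antisym to from
        where
        to : V (G ∖ (V G - x)) ⊆ ⁅ x ⁆
        to {y} y∈ with y ∈? ⁅ x ⁆
        ... | yes y∈x = y∈x
        ... | no y∉x = contradiction (x∈p∧x∉q⇒x∈p─q (p─q⊆p (V G) _ y∈) y∉x) (x∈p─q⇒x∉q (V G) _ y∈)
        from : ⁅ x ⁆ ⊆ V (G ∖ (V G - x))
        from y∈x with x∈⁅y⁆⇒x≡y x y∈x
        ... | refl = x∈p∧x∉q⇒x∈p─q (proj₂ w) λ x∈ → x∈p─q⇒x∉q (V G) _ x∈ (x∈⁅x⁆ x)

      trivial : DisconnectedOrTrivial (G ∖ (V G - x))
      trivial = inj₂ (trans (cong ∣_∣ single) (∣⁅x⁆∣≡1 x))

    least : ∃ (IsMinimum Disconnects)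
    least = minimum
      (λ s → anySubset? λ S → S ⊆? V G ×-dec disconnectedOrTrivial? {G = G ∖ S} ×-dec ∣ S ∣ ≟ s)
      (proj₂ allButOne)

    κ = proj₁ least
    isMin = proj₂ least

    k≤κ : k ≤ κ
    k≤κ with proj₁ isMin
    ... | S , _ , d , ∣S∣≡κ = subst (k ≤_) ∣S∣≡κ (disconnecting-large ρ {S} d)

  -- A minimum separator `S` misses some vertex, because the empty graph is connected and not of
  -- order 1; so the order exceeds `k`. The boundary of any separation disconnects the graph when
  -- deleted, so it competes with `S`.
  KConnected⇒robust : KConnected k G → Robust G k (V G)
  KConnected⇒robust (κ , ((S , S⊆V , d , ∣S∣≡κ) , minimal) , k≤κ) = record
    { order>k = ≤-<-trans (subst (k ≤_) (sym ∣S∣≡κ) k≤κ) (p⊂q⇒∣p∣<∣q∣ (S⊆V , outsideS (remaining d)))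
    ; boundary≥k = λ {A} {B} σ → ≤-trans k≤κ
        (minimal (boundary (V G) A B , p─q⊆p (V G) _ , inj₁ (cut⇒¬connected (cut σ)) , refl)) }
    where
    remaining : DisconnectedOrTrivial (G ∖ S) → Nonempty (V G ─ S)
    remaining (inj₂ ≡1) = 0<∣p∣⇒Nonempty (≤-reflexive (sym ≡1))
    remaining (inj₁ ¬conn) with nonempty? (V G ─ S)
    ... | yes ne = ne
    ... | no em = ⊥-elim (¬conn λ u∈ → contradiction (_ , u∈) em)

    outsideS : Nonempty (V G ─ S) → ∃ λ x → x ∈ V G × x ∉ S
    outsideS (x , x∈) = x , p─q⊆p (V G) S x∈ , x∈p─q⇒x∉q (V G) S x∈

    cut : ∀ {A B} → Separation G (V G) A B → Cut {G = G ∖ boundary (V G) A B}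
    cut {A} {B} σ = A , B , record
      { left⊆W = λ x∈A → x∈p∧x∉q⇒x∈p─q (left⊆W σ x∈A) λ x∈T → proj₁ (proj₂ (boundary⁻ {A = A} {B} x∈T)) x∈A
      ; right⊆W = λ x∈B → x∈p∧x∉q⇒x∈p─q (right⊆W σ x∈B) λ x∈T → proj₂ (proj₂ (boundary⁻ {A = A} {B} x∈T)) x∈B
      ; left≠∅ = left≠∅ σ ; right≠∅ = right≠∅ σ ; disjoint = disjoint σ
      ; noEdge = λ x∈A y∈B (x~y , _) → noEdge σ x∈A y∈B x~y } , cover
      where
      cover : V G ─ boundary (V G) A B ⊆ A ∪ B
      cover {x} x∈ with x ∈? (A ∪ B)
      ... | yes x∈∪ = x∈∪
      ... | no  x∉∪ = contradiction (x∈p∧x∉q⇒x∈p─q (p─q⊆p (V G) _ x∈) x∉∪) (x∈p─q⇒x∉q (V G) _ x∈)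

-- Fragments and uncrossing.

Fragment : {N : ℕ} → Graph N → ℕ → (W A B : Subset N) → Set
Fragment G k W A B = Separation G W A B × ∣ boundary W A B ∣ ≤ k

boundary-comm : ∀ {n} (W A B : Subset n) → boundary W A B ≡ boundary W B A
boundary-comm W A B = cong (W ─_) (∪-comm A B)

module _ {N : ℕ} {G : Graph N} {k : ℕ} where
  open Graph G using (_~_) renaming (sym to ~-sym)

  swapFragment : ∀ {W A B} → Fragment G k W A B → Fragment G k W B A
  swapFragment {W} {A} {B} (σ , ≤k) = swap σ , subst (_≤ k) (cong ∣_∣ (boundary-comm W A B)) ≤k

  corner : ∀ {W A B A′ B′} → Separation G W A B → Separation G W A′ B′ → Nonempty (A ∩ A′) →
    Separation G W (A ∩ A′) (B ∪ B′)
  corner {A = A} {B} {A′} {B′} σ σ′ ne = record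
    { left⊆W   = left⊆W σ ∘ proj₁ ∘ x∈p∩q⁻ A A′
    ; right⊆W  = [ right⊆W σ , right⊆W σ′ ]′ ∘ x∈p∪q⁻ B B′
    ; left≠∅   = ne
    ; right≠∅  = proj₁ (right≠∅ σ) , x∈p∪q⁺ (inj₁ (proj₂ (right≠∅ σ)))
    ; disjoint = λ x∈ x∈′ → [ disjoint σ (proj₁ (x∈p∩q⁻ A A′ x∈)) , disjoint σ′ (proj₂ (x∈p∩q⁻ A A′ x∈)) ]′
                             (x∈p∪q⁻ B B′ x∈′)
    ; noEdge   = λ x∈ y∈ x~y → [ (λ y∈B → noEdge σ (proj₁ (x∈p∩q⁻ A A′ x∈)) y∈B x~y)
                               , (λ y∈B′ → noEdge σ′ (proj₂ (x∈p∩q⁻ A A′ x∈)) y∈B′ x~y) ]′ (x∈p∪q⁻ B B′ y∈) }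

  module _ {W A B A′ B′ : Subset N} where

    -- A vertex in the boundary of either corner lies in one of the two original boundaries. A
    -- vertex in both corner boundaries avoids all four sides, so it lies in both original ones.
    boundary-submodular :
      ∣ boundary W (A ∩ A′) (B ∪ B′) ∣ + ∣ boundary W (B ∩ B′) (A ∪ A′) ∣ ≤
      ∣ boundary W A B ∣ + ∣ boundary W A′ B′ ∣
    boundary-submodular = ∣p∣+∣q∣≤ union intersection
      where
      T  = boundary W A B
      T′ = boundary W A′ B′
      T₁ = boundary W (A ∩ A′) (B ∪ B′)
      T₂ = boundary W (B ∩ B′) (A ∪ A′)
      union : T₁ ∪ T₂ ⊆ T ∪ T′
      union {x} x∈ with x∈p∪q⁻ T₁ T₂ x∈
      ... | inj₁ x∈T₁ with boundary⁻ {A = A ∩ A′} {B ∪ B′} x∈T₁ | x ∈? A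
      ...   | x∈W , x∉∩ , x∉∪ | yes x∈A =
        x∈p∪q⁺ (inj₂ (boundary⁺ x∈W (λ x∈A′ → x∉∩ (x∈p∩q⁺ (x∈A , x∈A′))) (x∉∪ ∘ x∈p∪q⁺ ∘ inj₂)))
      ...   | x∈W , x∉∩ , x∉∪ | no x∉A =
        x∈p∪q⁺ (inj₁ (boundary⁺ x∈W x∉A (x∉∪ ∘ x∈p∪q⁺ ∘ inj₁)))
      union {x} x∈ | inj₂ x∈T₂ with boundary⁻ {A = B ∩ B′} {A ∪ A′} x∈T₂ | x ∈? B
      ...   | x∈W , x∉∩ , x∉∪ | yes x∈B =
        x∈p∪q⁺ (inj₂ (boundary⁺ x∈W (x∉∪ ∘ x∈p∪q⁺ ∘ inj₂) (λ x∈B′ → x∉∩ (x∈p∩q⁺ (x∈B , x∈B′)))))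
      ...   | x∈W , x∉∩ , x∉∪ | no x∉B =
        x∈p∪q⁺ (inj₁ (boundary⁺ x∈W (x∉∪ ∘ x∈p∪q⁺ ∘ inj₁) x∉B))
      intersection : T₁ ∩ T₂ ⊆ T ∩ T′
      intersection x∈ with x∈p∩q⁻ T₁ T₂ x∈
      ... | x∈T₁ , x∈T₂ with boundary⁻ {A = A ∩ A′} {B ∪ B′} x∈T₁ | boundary⁻ {A = B ∩ B′} {A ∪ A′} x∈T₂
      ...   | x∈W , _ , x∉B∪B′ | _ , _ , x∉A∪A′ = x∈p∩q⁺
        ( boundary⁺ x∈W (x∉A∪A′ ∘ x∈p∪q⁺ ∘ inj₁) (x∉B∪B′ ∘ x∈p∪q⁺ ∘ inj₁)
        , boundary⁺ x∈W (x∉A∪A′ ∘ x∈p∪q⁺ ∘ inj₂) (x∉B∪B′ ∘ x∈p∪q⁺ ∘ inj₂))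

    -- The opposite corner is nonempty, so robustness gives it a boundary of at least `k`. Of the
    -- total of at most `k + k`, at most `k` is left for this corner.
    cornerFragment : Robust G k W → Fragment G k W A B → Fragment G k W A′ B′ →
      Nonempty (A ∩ A′) → Nonempty (B ∩ B′) → Fragment G k W (A ∩ A′) (B ∪ B′)
    cornerFragment ρ (σ , ≤k) (σ′ , ≤k′) ne ne′ =
      corner σ σ′ ne , +-cancelʳ-≤ k _ _ (begin
        ∣ boundary W (A ∩ A′) (B ∪ B′) ∣ + k
          ≤⟨ +-monoʳ-≤ _ (boundary≥k ρ (corner (swap σ) (swap σ′) ne′)) ⟩
        ∣ boundary W (A ∩ A′) (B ∪ B′) ∣ + ∣ boundary W (B ∩ B′) (A ∪ A′) ∣
          ≤⟨ boundary-submodular ⟩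
        ∣ boundary W A B ∣ + ∣ boundary W A′ B′ ∣
          ≤⟨ +-mono-≤ ≤k ≤k′ ⟩
        k + k ∎)
      where open ≤-Reasoning

  -- A subset of `W` with more than `k` vertices does not fit into the boundary.
  meets : ∀ {W A B C} → C ⊆ W → k < ∣ C ∣ → Fragment G k W A B →
    Nonempty (C ∩ A) ⊎ Nonempty (C ∩ B)
  meets {W} {A} {B} {C} C⊆W k<C (_ , ≤k) with nonempty? (C ∩ A) | nonempty? (C ∩ B)
  ... | yes ne | _      = inj₁ ne
  ... | no _   | yes ne = inj₂ ne
  ... | no ∅A  | no ∅B  = contradiction (≤-trans (p⊆q⇒∣p∣≤∣q∣ C⊆T) ≤k) (<⇒≱ k<C)
    where
    C⊆T : C ⊆ boundary W A B
    C⊆T x∈C = boundary⁺ (C⊆W x∈C)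
      (λ x∈A → ∅A (_ , x∈p∩q⁺ (x∈C , x∈A)))
      (λ x∈B → ∅B (_ , x∈p∩q⁺ (x∈C , x∈B)))

  -- All four sides are too large for a boundary, so if one corner is empty, the two corners
  -- adjacent to it are not. Hence some pair of opposite corners is nonempty, and its member inside
  -- `A` is the new fragment. Being a corner, it also misses the boundary of the second separation.
  uncross : ∀ {W A B A′ B′} → Robust G k W → (∀ {C D} → Fragment G k W C D → k < ∣ C ∣) →
    Fragment G k W A B → Fragment G k W A′ B′ → ∃₂ λ C D → Fragment G k W C D × C ⊆ A × C ⊆ A′ ∪ B′
  uncross {W} {A} {B} {A′} {B′} ρ large φ φ′ = decide (nonempty? (A ∩ A′)) (nonempty? (B ∩ B′))
    where
    comm : ∀ p q → Nonempty (p ∩ q) → Nonempty (q ∩ p)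
    comm p q = subst Nonempty (∩-comm p q)

    meets′ : ∀ {C D E F} → Fragment G k W C D → Fragment G k W E F →
      Nonempty (C ∩ E) ⊎ Nonempty (C ∩ F)
    meets′ ψ = meets (left⊆W (proj₁ ψ)) (large ψ)

    crossed : Nonempty (A ∩ B′) → Nonempty (B ∩ A′) →
      ∃₂ λ C D → Fragment G k W C D × C ⊆ A × C ⊆ A′ ∪ B′
    crossed ne ne′ = _ , _ , cornerFragment ρ φ (swapFragment φ′) ne ne′ ,
      proj₁ ∘ x∈p∩q⁻ A B′ , x∈p∪q⁺ ∘ inj₂ ∘ proj₂ ∘ x∈p∩q⁻ A B′

    decide : Dec (Nonempty (A ∩ A′)) → Dec (Nonempty (B ∩ B′)) →
      ∃₂ λ C D → Fragment G k W C D × C ⊆ A × C ⊆ A′ ∪ B′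
    decide (yes ne) (yes ne′) = _ , _ , cornerFragment ρ φ φ′ ne ne′ ,
      proj₁ ∘ x∈p∩q⁻ A A′ , x∈p∪q⁺ ∘ inj₁ ∘ proj₂ ∘ x∈p∩q⁻ A A′
    -- `A` and `A′` do not meet, so `A` meets `B′` and `A′` meets `B`.
    decide (no ∅) _ = crossed
      ([ ⊥-elim ∘ ∅ , id ]′ (meets′ φ φ′))
      ([ ⊥-elim ∘ ∅ ∘ comm A′ A , comm A′ B ]′ (meets′ φ′ φ))
    -- Likewise, `B` and `B′` do not meet, so `B′` meets `A` and `B` meets `A′`.
    decide (yes _) (no ∅) = crossed
      ([ comm B′ A , ⊥-elim ∘ ∅ ∘ comm B′ B ]′ (meets′ (swapFragment φ′) φ))
      ([ id , ⊥-elim ∘ ∅ ]′ (meets′ (swapFragment φ) φ′))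

  -- Putting a vertex back.

  -- If one side of a separation of `W′` misses `W`, that side is just `p`, and the boundary
  -- contains all of `D`. Otherwise the separation restricts to `W`, and the restricted boundary
  -- lies in the original one.
  robust-addVertex : ∀ {W W′ D p} → Robust G k W → W ⊆ W′ → W′ ⊆ ⁅ p ⁆ ∪ W →
    D ⊆ W → (∀ {y} → y ∈ D → p ~ y) → k ≤ ∣ D ∣ → Robust G k W′
  robust-addVertex {W} {W′} {D} {p} ρ W⊆W′ W′⊆ D⊆W p~D k≤D = record
    { order>k = <-≤-trans (order>k ρ) (p⊆q⇒∣p∣≤∣q∣ W⊆W′) ; boundary≥k = bound }
    where
    isolated : ∀ {A B} → Separation G W′ A B → Empty (A ∩ W) → k ≤ ∣ boundary W′ A B ∣
    isolated {A} {B} σ ∅ = ≤-trans k≤D (p⊆q⇒∣p∣≤∣q∣ λ y∈D →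
      boundary⁺ (W⊆W′ (D⊆W y∈D)) (λ y∈A → ∅ (_ , x∈p∩q⁺ (y∈A , D⊆W y∈D)))
                (λ y∈B → noEdge σ p∈A y∈B (p~D y∈D)))
      where
      p∈A : p ∈ A
      p∈A with left≠∅ σ
      ... | a , a∈A with x∈p∪q⁻ ⁅ p ⁆ W (W′⊆ (left⊆W σ a∈A))
      ...   | inj₁ a∈p = subst (_∈ A) (x∈⁅y⁆⇒x≡y p a∈p) a∈A
      ...   | inj₂ a∈W = contradiction (a , x∈p∩q⁺ (a∈A , a∈W)) ∅

    bound : ∀ {A B} → Separation G W′ A B → k ≤ ∣ boundary W′ A B ∣
    bound {A} {B} σ with nonempty? (A ∩ W) | nonempty? (B ∩ W)
    ... | no ∅ | _    = isolated σ ∅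
    ... | yes _ | no ∅ = subst (k ≤_) (cong ∣_∣ (boundary-comm W′ B A)) (isolated (swap σ) ∅)
    ... | yes ne | yes ne′ = ≤-trans (boundary≥k ρ restricted) (p⊆q⇒∣p∣≤∣q∣ boundary⊆)
      where
      restricted : Separation G W (A ∩ W) (B ∩ W)
      restricted = record
        { left⊆W = proj₂ ∘ x∈p∩q⁻ A W ; right⊆W = proj₂ ∘ x∈p∩q⁻ B W ; left≠∅ = ne ; right≠∅ = ne′
        ; disjoint = λ x∈ x∈′ → disjoint σ (proj₁ (x∈p∩q⁻ A W x∈)) (proj₁ (x∈p∩q⁻ B W x∈′))
        ; noEdge = λ x∈ y∈ → noEdge σ (proj₁ (x∈p∩q⁻ A W x∈)) (proj₁ (x∈p∩q⁻ B W y∈)) }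
      boundary⊆ : boundary W (A ∩ W) (B ∩ W) ⊆ boundary W′ A B
      boundary⊆ x∈T with boundary⁻ {A = A ∩ W} {B ∩ W} x∈T
      ... | x∈W , x∉A , x∉B = boundary⁺ (W⊆W′ x∈W) (λ x∈A → x∉A (x∈p∩q⁺ (x∈A , x∈W)))
                                                   (λ x∈B → x∉B (x∈p∩q⁺ (x∈B , x∈W)))

  -- Only `x` can join the boundary, which turns the strict bound into a weak one.
  reinsert : ∀ {W W′ A B} x → W ⊆ W′ → W′ ⊆ ⁅ x ⁆ ∪ W →
    Separation G W A B → ∣ boundary W A B ∣ < k → Fragment G k W′ A B
  reinsert {W} {W′} {A} {B} x W⊆W′ W′⊆ σ small = record
    { left⊆W = W⊆W′ ∘ left⊆W σ ; right⊆W = W⊆W′ ∘ right⊆W σ ; left≠∅ = left≠∅ σ ; right≠∅ = right≠∅ σ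
    ; disjoint = disjoint σ ; noEdge = noEdge σ } ,
    ≤-trans (p⊆q⇒∣p∣≤∣q∣ boundary⊆) (≤-trans (∣⁅x⁆∪p∣≤1+∣p∣ x _) small)
    where
    boundary⊆ : boundary W′ A B ⊆ ⁅ x ⁆ ∪ boundary W A B
    boundary⊆ {y} y∈T with boundary⁻ {A = A} {B} y∈T
    ... | y∈W′ , y∉A , y∉B with x∈p∪q⁻ ⁅ x ⁆ W (W′⊆ y∈W′)
    ...   | inj₁ y∈x = x∈p∪q⁺ (inj₁ y∈x)
    ...   | inj₂ y∈W = x∈p∪q⁺ (inj₂ (boundary⁺ y∈W y∉A y∉B))

-- Paths, their free neighbours and the remaining vertices.

vertexSet-size : ∀ {N j} (vs : Vec (Fin N) j) → ∣ ⋃ (List.map ⁅_⁆ (toList vs)) ∣ ≤ j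
vertexSet-size {N} [] = ≤-reflexive (∣⊥∣≡0 N)
vertexSet-size (v ∷ vs) = ≤-trans (∣⁅x⁆∪p∣≤1+∣p∣ v _) (s≤s (vertexSet-size vs))

∉vertexSet⁺ : ∀ {N j x} {vs : Vec (Fin N) j} → All (x ≢_) vs → x ∉ ⋃ (List.map ⁅_⁆ (toList vs))
∉vertexSet⁺ [] = ∉⊥
∉vertexSet⁺ {vs = v ∷ vs} (x≢v ∷ x≢vs) = [ x≢v ∘ x∈⁅y⁆⇒x≡y v , ∉vertexSet⁺ x≢vs ]′ ∘ x∈p∪q⁻ ⁅ v ⁆ _

∉vertexSet⁻ : ∀ {N j x} (vs : Vec (Fin N) j) → x ∉ ⋃ (List.map ⁅_⁆ (toList vs)) → All (x ≢_) vs
∉vertexSet⁻ [] _ = []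
∉vertexSet⁻ (v ∷ vs) x∉ = (λ { refl → x∉ (x∈p∪q⁺ (inj₁ (x∈⁅x⁆ v))) }) ∷ ∉vertexSet⁻ vs (x∉ ∘ x∈p∪q⁺ ∘ inj₂)

module _ {N : ℕ} {G : Graph N} where
  open Graph G using (_~_; _~?_; inV) renaming (sym to ~-sym)

  ∈neighbours⁻ : ∀ {u v} → u ∈ neighbours G v → v ~ u
  ∈neighbours⁻ {u} {v} u∈ = fromDoes (v ~? u) (trans (sym (lookup∘tabulate _ u)) ([]=⇒lookup u∈))
    where
    fromDoes : ∀ {A : Set} (A? : Dec A) → does A? ≡ true → A
    fromDoes (yes a) _ = a

  MinDegree≥⇒degree≥ : ∀ {d} → MinDegree≥ G d → ∀ {v} → v ∈ V G → d ≤ degree G v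
  MinDegree≥⇒degree≥ (δ , (_ , minimal) , d≤δ) v∈V = ≤-trans d≤δ (minimal (_ , v∈V , refl))

  -- Two of any three vertices lie on the same side, so they are not adjacent.
  bipartite⇒triangleFree : Bipartite G → ∀ {u v w} → u ~ v → u ~ w → ¬ v ~ w
  bipartite⇒triangleFree (X , Y , _ , X∩Y≡⊥ , across) {u} {v} {w} u~v u~w v~w =
    go (across u~v) (across u~w) (across v~w)
    where
    Ends : Fin N → Fin N → Set
    Ends x y = (x ∈ X × y ∈ Y) ⊎ (x ∈ Y × y ∈ X)

    disj : ∀ {x} → x ∈ X → ¬ (x ∈ Y)
    disj x∈X x∈Y = ∉⊥ (subst (_ ∈_) X∩Y≡⊥ (x∈p∩q⁺ (x∈X , x∈Y)))

    go : Ends u v → Ends u w → Ends v w → Empty.⊥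
    go (inj₁ (u∈X , _))   (inj₂ (u∈Y , _))   _                  = disj u∈X u∈Y
    go (inj₂ (u∈Y , _))   (inj₁ (u∈X , _))   _                  = disj u∈X u∈Y
    go (inj₁ (_   , v∈Y)) (inj₁ _)           (inj₁ (v∈X , _))   = disj v∈X v∈Y
    go (inj₁ _)           (inj₁ (_   , w∈Y)) (inj₂ (_   , w∈X)) = disj w∈X w∈Y
    go (inj₂ _)           (inj₂ (_   , w∈X)) (inj₁ (_   , w∈Y)) = disj w∈X w∈Y
    go (inj₂ (_   , v∈X)) (inj₂ _)           (inj₂ (v∈Y , _))   = disj v∈X v∈Y

  remaining : ∀ {j} → Path G j → Subset N
  remaining P = V G ─ vertexSet P

  freeNeighbours : ∀ {j} → Fin N → Path G j → Subset N
  freeNeighbours v P = neighbours G v ─ vertexSet P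

  ∈freeNeighbours⁻ : ∀ {j v y} (P : Path G j) → y ∈ freeNeighbours v P → v ~ y × y ∈ remaining P
  ∈freeNeighbours⁻ {v = v} P y∈ = v~y ,
    x∈p∧x∉q⇒x∈p─q (inV (~-sym v~y)) (x∈p─q⇒x∉q (neighbours G v) (vertexSet P) y∈)
    where v~y = ∈neighbours⁻ (p─q⊆p (neighbours G v) (vertexSet P) y∈)

  -- Paths grow at the head of the vector: the end vertex in play is its first entry, and dropping
  -- that vertex means taking the tail.
  extend : ∀ {j x} (P : Path G j) → x ∈ remaining P → Linked _~_ (x ∷ Path.vertices P) → Path G (suc j)
  extend {x = x} P x∈ link = record
    { vertices = x ∷ Path.vertices P
    ; inside   = p─q⊆p (V G) (vertexSet P) x∈ ∷ Path.inside P
    ; distinct = ∉vertexSet⁻ (Path.vertices P) (x∈p─q⇒x∉q (V G) (vertexSet P) x∈) ∷ Path.distinct P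
    ; linked   = link }

  remaining-extend⊆ : ∀ {x} {S : Subset N} → V G ─ (⁅ x ⁆ ∪ S) ⊆ V G ─ S
  remaining-extend⊆ {x} {S} y∈ = x∈p∧x∉q⇒x∈p─q (p─q⊆p (V G) (⁅ x ⁆ ∪ S) y∈)
    (x∈p─q⇒x∉q (V G) (⁅ x ⁆ ∪ S) y∈ ∘ x∈p∪q⁺ ∘ inj₂)

  remaining⊆extend : ∀ {x} {S : Subset N} → V G ─ S ⊆ ⁅ x ⁆ ∪ (V G ─ (⁅ x ⁆ ∪ S))
  remaining⊆extend {x} {S} {y} y∈ with y ∈? ⁅ x ⁆
  ... | yes y∈x = x∈p∪q⁺ (inj₁ y∈x)
  ... | no  y∉x = x∈p∪q⁺ (inj₂ (x∈p∧x∉q⇒x∈p─q (p─q⊆p (V G) S y∈)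
                    ([ y∉x , x∈p─q⇒x∉q (V G) S y∈ ]′ ∘ x∈p∪q⁻ ⁅ x ⁆ S)))

  -- Degree counts outside a short path.

  module _ {k m : ℕ} (1≤k : 1 ≤ k) (minDegree : ∀ {v} → v ∈ V G → k + m ≤ degree G v)
           (triangleFree : ∀ {u v w} → u ~ v → u ~ w → ¬ v ~ w) where

    ∣freeNeighbours∣ : ∀ {j v} (P : Path G j) → v ∈ V G → k + m ≤ ∣ freeNeighbours v P ∣ + j
    ∣freeNeighbours∣ {v = v} P v∈V = ≤-trans (minDegree v∈V)
      (≤-trans (∣p∣≤∣p─q∣+∣q∣ {p = neighbours G v} {vertexSet P})
               (+-monoʳ-≤ _ (vertexSet-size (Path.vertices P))))

    k≤∣freeNeighbours∣ : ∀ {j v} (P : Path G j) → j ≤ m → v ∈ V G → k ≤ ∣ freeNeighbours v P ∣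
    k≤∣freeNeighbours∣ P j≤m v∈V =
      +-cancelʳ-≤ m _ _ (≤-trans (∣freeNeighbours∣ P v∈V) (+-monoʳ-≤ _ j≤m))

    -- The path takes up at most `j` of the `k + m` neighbours; `j < m` leaves one to spare.
    k<∣freeNeighbours∣ : ∀ {j v} (P : Path G j) → j < m → v ∈ V G → k < ∣ freeNeighbours v P ∣
    k<∣freeNeighbours∣ {j} P j<m v∈V = +-cancelʳ-≤ j _ _
      (≤-trans (≤-reflexive (sym (+-suc k j))) (≤-trans (+-monoʳ-≤ k j<m) (∣freeNeighbours∣ P v∈V)))

    k+m<∣V∣ : Nonempty (V G) → k + m < ∣ V G ∣
    k+m<∣V∣ (v , v∈V) = ≤-<-trans (≤-trans (minDegree v∈V) (p⊆q⇒∣p∣≤∣q∣ N⊆V-v)) (x∈p⇒∣p-x∣<∣p∣ v∈V)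
      where
      N⊆V-v : neighbours G v ⊆ V G - v
      N⊆V-v u∈ = x∈p∧x≢y⇒x∈p-y (inV (~-sym v~u)) λ u≡v → Graph.irrefl G (sym u≡v) v~u
        where v~u = ∈neighbours⁻ u∈

    k<∣remaining∣ : ∀ {j} (P : Path G j) → j ≤ m → Nonempty (V G) → k < ∣ remaining P ∣
    k<∣remaining∣ P j≤m ne = +-cancelʳ-≤ m _ _ (≤-trans (k+m<∣V∣ ne)
      (≤-trans (∣p∣≤∣p─q∣+∣q∣ {p = V G} {vertexSet P})
               (+-monoʳ-≤ _ (≤-trans (vertexSet-size (Path.vertices P)) j≤m))))

    -- A vertex `v` of `A` has more than `k` free neighbours, all in `A` or the boundary `T`, so
    -- some neighbour `w` lies in `A`. The free neighbourhoods of `v` and `w` are disjoint subsets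
    -- of `A ∪ T`, and `T` accounts for at most `k` of their vertices.
    fragment-large : ∀ {j} (P : Path G j) → j < m → ∀ {A B} → Fragment G k (remaining P) A B → k < ∣ A ∣
    fragment-large P j<m {A} {B} (σ , ≤k) = +-cancelʳ-≤ k _ _ (begin
      suc k + k              ≤⟨ +-mono-≤ (big v∈V) (<⇒≤ (big w∈V)) ⟩
      ∣ D v ∣ + ∣ D w ∣      ≤⟨ ∣p∣+∣q∣≤ {r = A} {T} D∪D⊆ D∩D⊆ ⟩
      ∣ A ∣ + ∣ T ∣          ≤⟨ +-monoʳ-≤ _ ≤k ⟩
      ∣ A ∣ + k              ∎)
      where
      open ≤-Reasoning
      T = boundary (remaining P) A B
      D = λ u → freeNeighbours u P
      v = proj₁ (left≠∅ σ)
      v∈A = proj₂ (left≠∅ σ)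

      inG : ∀ {u} → u ∈ A → u ∈ V G
      inG = p─q⊆p (V G) (vertexSet P) ∘ left⊆W σ

      v∈V = inG v∈A

      big : ∀ {u} → u ∈ V G → k < ∣ D u ∣
      big = k<∣freeNeighbours∣ P j<m

      D⊆ : ∀ {u} → u ∈ A → D u ⊆ A ∪ T
      D⊆ u∈A {y} y∈D with ∈freeNeighbours⁻ P y∈D | y ∈? A
      ... | u~y , y∈W | yes y∈A = x∈p∪q⁺ (inj₁ y∈A)
      ... | u~y , y∈W | no  y∉A = x∈p∪q⁺ (inj₂ (boundary⁺ y∈W y∉A λ y∈B → noEdge σ u∈A y∈B u~y))

      inner : Nonempty (D v ∩ A)
      inner with nonempty? (D v ∩ A)
      ... | yes ne = ne
      ... | no ∅ = contradiction (≤-trans (p⊆q⇒∣p∣≤∣q∣ D⊆T) ≤k) (<⇒≱ (big v∈V))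
        where
        D⊆T : D v ⊆ T
        D⊆T y∈D with x∈p∪q⁻ A T (D⊆ v∈A y∈D)
        ... | inj₁ y∈A = contradiction (_ , x∈p∩q⁺ (y∈D , y∈A)) ∅
        ... | inj₂ y∈T = y∈T

      w = proj₁ inner
      w∈A = proj₂ (x∈p∩q⁻ (D v) A (proj₂ inner))
      v~w = proj₁ (∈freeNeighbours⁻ P (proj₁ (x∈p∩q⁻ (D v) A (proj₂ inner))))
      w∈V = inG w∈A

      D∪D⊆ : D v ∪ D w ⊆ A ∪ T
      D∪D⊆ = [ D⊆ v∈A , D⊆ w∈A ]′ ∘ x∈p∪q⁻ (D v) (D w)

      -- The intersection is empty: a common neighbour would close a triangle with `v` and `w`.
      D∩D⊆ : D v ∩ D w ⊆ A ∩ T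
      D∩D⊆ y∈ with x∈p∩q⁻ (D v) (D w) y∈
      ... | y∈Dv , y∈Dw = contradiction (proj₁ (∈freeNeighbours⁻ P y∈Dw))
                                        (triangleFree v~w (proj₁ (∈freeNeighbours⁻ P y∈Dv)))

    -- Descent on the size of a fragment.

    -- Path and opposite side may change, but `A` is fixed, so the descent measure is not disturbed.
    Attached : Subset N → Set
    Attached A = ∃ λ j → ∃ λ (P : Path G j) → j < m × Robust G k (remaining P) ×
      (∃ λ B → Fragment G k (remaining P) A B) × (∃ λ x → x ∈ A × Linked _~_ (x ∷ Path.vertices P))

    -- Recursion on the vertices of `P`. It stops at the latest at the empty path, which extends to
    -- any vertex of `A`.
    attach : ∀ {j A B} (P : Path G j) → j < m → Robust G k (remaining P) →
      Fragment G k (remaining P) A B → Attached A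
    attach P@(record { vertices = [] }) j<m ρ φ@(σ , _) =
      _ , P , j<m , ρ , (_ , φ) , proj₁ (left≠∅ σ) , proj₂ (left≠∅ σ) , [-]
    attach {A = A} {B}
           P@(record { vertices = p ∷ ps ; inside = p∈V ∷ ps∈V ; distinct = p≢ps ∷ ps≢ ; linked = link })
           j<m ρ φ@(σ , ≤k) with any? (λ x → x ∈? A ×-dec p ~? x)
    ... | yes (x , x∈A , p~x) = _ , P , j<m , ρ , (_ , φ) , x , x∈A , ~-sym p~x ∷ link
    ... | no ¬adjacent = attach Q (<⇒≤ j<m)
      (robust-addVertex ρ ⊆Q Q⊆ (proj₂ ∘ ∈freeNeighbours⁻ P) (proj₁ ∘ ∈freeNeighbours⁻ P)
                        (k≤∣freeNeighbours∣ P (<⇒≤ j<m) p∈V))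
      (τ , ≤-trans (p⊆q⇒∣p∣≤∣q∣ boundary⊆) ≤k)
      where
      Q : Path G _
      Q = record { vertices = ps ; inside = ps∈V ; distinct = ps≢ ; linked = Linked.tail link }

      ⊆Q : remaining P ⊆ remaining Q
      ⊆Q = remaining-extend⊆

      Q⊆ : remaining Q ⊆ ⁅ p ⁆ ∪ remaining P
      Q⊆ = remaining⊆extend

      p∉P : p ∉ remaining P
      p∉P p∈ = x∈p─q⇒x∉q (V G) (vertexSet P) p∈ (x∈p∪q⁺ (inj₁ (x∈⁅x⁆ p)))

      -- With no neighbour in `A`, the dropped vertex `p` may join the other side, so the boundary
      -- does not grow.
      τ : Separation G (remaining Q) A (⁅ p ⁆ ∪ B)
      τ = record
        { left⊆W   = ⊆Q ∘ left⊆W σ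
        ; right⊆W  = [ (λ x∈p → subst (_∈ remaining Q) (sym (x∈⁅y⁆⇒x≡y p x∈p))
                                  (x∈p∧x∉q⇒x∈p─q p∈V (∉vertexSet⁺ p≢ps)))
                     , ⊆Q ∘ right⊆W σ ]′ ∘ x∈p∪q⁻ ⁅ p ⁆ B
        ; left≠∅   = left≠∅ σ
        ; right≠∅  = p , x∈p∪q⁺ (inj₁ (x∈⁅x⁆ p))
        ; disjoint = λ x∈A → [ (λ x∈p → p∉P (subst (_∈ remaining P) (x∈⁅y⁆⇒x≡y p x∈p) (left⊆W σ x∈A)))
                             , disjoint σ x∈A ]′ ∘ x∈p∪q⁻ ⁅ p ⁆ B
        ; noEdge   = λ {x} x∈A y∈ x~y →
            [ (λ y∈p → ¬adjacent (x , x∈A , ~-sym (subst (x ~_) (x∈⁅y⁆⇒x≡y p y∈p) x~y)))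
            , (λ y∈B → noEdge σ x∈A y∈B x~y) ]′ (x∈p∪q⁻ ⁅ p ⁆ B y∈) }

      boundary⊆ : boundary (remaining Q) A (⁅ p ⁆ ∪ B) ⊆ boundary (remaining P) A B
      boundary⊆ y∈ with boundary⁻ {A = A} {⁅ p ⁆ ∪ B} y∈
      ... | y∈Q , y∉A , y∉pB with x∈p∪q⁻ ⁅ p ⁆ (remaining P) (Q⊆ y∈Q)
      ...   | inj₁ y∈p = contradiction (x∈p∪q⁺ (inj₁ y∈p)) y∉pB
      ...   | inj₂ y∈P = boundary⁺ y∈P y∉A (y∉pB ∘ x∈p∪q⁺ ∘ inj₂)

    fragment-extend : ∀ {j x A B} (P : Path G j) (x∈P : x ∈ remaining P)
      (link : Linked _~_ (x ∷ Path.vertices P)) →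
      j < m → x ∈ A → Fragment G k (remaining P) A B →
      Fragment G k (remaining (extend P x∈P link)) (A - x) B
    fragment-extend {x = x} {A} {B} P x∈P link j<m x∈A φ@(σ , ≤k) =
      record
        { left⊆W   = λ y∈ → into (left⊆W σ (p─q⊆p A ⁅ x ⁆ y∈)) (x∈p─q⇒x∉q A ⁅ x ⁆ y∈)
        ; right⊆W  = λ y∈B → into (right⊆W σ y∈B)
            λ y∈x → disjoint σ x∈A (subst (_∈ B) (x∈⁅y⁆⇒x≡y x y∈x) y∈B)
        -- `A` has more than `k ≥ 1` vertices, so one is left after removing `x`.
        ; left≠∅   = 0<∣p∣⇒Nonempty (s≤s⁻¹ (≤-trans (s≤s 1≤k) (≤-trans (fragment-large P j<m φ) ∣A∣≤)))
        ; right≠∅  = right≠∅ σ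
        ; disjoint = disjoint σ ∘ p─q⊆p A ⁅ x ⁆
        ; noEdge   = noEdge σ ∘ p─q⊆p A ⁅ x ⁆ } ,
      ≤-trans (p⊆q⇒∣p∣≤∣q∣ boundary⊆) ≤k
      where
      P⁺ = extend P x∈P link

      into : ∀ {y} → y ∈ remaining P → y ∉ ⁅ x ⁆ → y ∈ remaining P⁺
      into y∈P y∉x = [ ⊥-elim ∘ y∉x , id ]′ (x∈p∪q⁻ ⁅ x ⁆ (remaining P⁺) (remaining⊆extend y∈P))

      ∣A∣≤ : ∣ A ∣ ≤ suc ∣ A - x ∣
      ∣A∣≤ = ≤-trans (∣p∣≤∣p─q∣+∣q∣ {p = A} {⁅ x ⁆})
        (≤-reflexive (trans (+-comm _ ∣ ⁅ x ⁆ ∣) (cong (_+ ∣ A - x ∣) (∣⁅x⁆∣≡1 x))))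

      x∉P⁺ : x ∉ remaining P⁺
      x∉P⁺ x∈ = x∈p─q⇒x∉q (V G) (vertexSet P⁺) x∈ (x∈p∪q⁺ (inj₁ (x∈⁅x⁆ x)))

      boundary⊆ : boundary (remaining P⁺) (A - x) B ⊆ boundary (remaining P) A B
      boundary⊆ y∈ with boundary⁻ {A = A - x} {B} y∈
      ... | y∈P⁺ , y∉A-x , y∉B = boundary⁺ (remaining-extend⊆ y∈P⁺)
        (λ y∈A → y∉A-x (x∈p∧x≢y⇒x∈p-y y∈A λ y≡x → x∉P⁺ (subst (_∈ remaining P⁺) y≡x y∈P⁺))) y∉B

    KeepingPath : Set
    KeepingPath = ∃ λ (P : Path G m) → Robust G k (remaining P)

    -- A separation that is too small without `x` becomes a fragment once `x` is put back, with `x`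
    -- in its boundary.
    extend? : ∀ {j x} (P : Path G j) (x∈P : x ∈ remaining P) (link : Linked _~_ (x ∷ Path.vertices P)) →
      j < m → Robust G k (remaining (extend P x∈P link)) ⊎
              (∃₂ λ C D → Fragment G k (remaining P) C D × x ∉ C ∪ D)
    extend? {x = x} P x∈P link j<m
      with robust⊎separated (k<∣remaining∣ (extend P x∈P link) j<m (x , p─q⊆p (V G) (vertexSet P) x∈P))
    ... | inj₁ ρ⁺ = inj₁ ρ⁺
    ... | inj₂ (C , D , σ , small) =
      inj₂ (C , D , reinsert x remaining-extend⊆ remaining⊆extend σ small ,
            [ x∉P⁺ ∘ left⊆W σ , x∉P⁺ ∘ right⊆W σ ]′ ∘ x∈p∪q⁻ C D)
      where
      x∉P⁺ : x ∉ remaining (extend P x∈P link)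
      x∉P⁺ x∈ = x∈p─q⇒x∉q (V G) (⁅ x ⁆ ∪ vertexSet P) x∈ (x∈p∪q⁺ (inj₁ (x∈⁅x⁆ x)))

    -- Since `attach` may shorten the path, its order is no measure of progress. Each recursive call
    -- instead removes `x` from the fragment.
    descend : ∀ {j A B} (P : Path G j) → j < m → Robust G k (remaining P) →
      Fragment G k (remaining P) A B → Acc _<_ ∣ A ∣ → KeepingPath
    descend {A = A} P₀ j<m₀ ρ₀ φ₀ (acc rec) with attach P₀ j<m₀ ρ₀ φ₀
    ... | j , P , j<m , ρ , (B , φ) , x , x∈A , link with left⊆W (proj₁ φ) x∈A
    ...   | x∈P with extend? P x∈P link j<m | m≤n⇒m<n∨m≡n j<m
    ...     | inj₁ ρ⁺ | inj₂ refl  = extend P x∈P link , ρ⁺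
    ...     | inj₁ ρ⁺ | inj₁ 1+j<m = descend (extend P x∈P link) 1+j<m ρ⁺
      (fragment-extend P x∈P link j<m x∈A φ) (rec (x∈p⇒∣p-x∣<∣p∣ x∈A))
    -- The new fragment `E` lies in `A` and in `C ∪ D`; the latter misses `x`, so `E` is strictly
    -- smaller than `A`.
    ...     | inj₂ (C , D , φ′ , x∉C∪D) | _ with uncross ρ (fragment-large P j<m) φ φ′
    ...       | E , F , ψ , E⊆A , E⊆C∪D =
      descend P j<m ρ ψ (rec (p⊂q⇒∣p∣<∣q∣ (E⊆A , x , x∈A , x∉C∪D ∘ E⊆C∪D)))

    -- Greedy growth and conclusion.

    next : ∀ {j} (P : Path G j) → j < m → Robust G k (remaining P) →
      ∃ λ x → x ∈ remaining P × Linked _~_ (x ∷ Path.vertices P)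
    next P@(record { vertices = [] }) _ ρ =
      let x , x∈P = 0<∣p∣⇒Nonempty (≤-<-trans z≤n (order>k ρ)) in x , x∈P , [-]
    next P@(record { vertices = p ∷ ps ; inside = p∈V ∷ _ ; linked = link }) j<m _ =
      let x , x∈D = 0<∣p∣⇒Nonempty (≤-<-trans z≤n (k<∣freeNeighbours∣ P j<m p∈V))
          p~x , x∈P = ∈freeNeighbours⁻ P x∈D
      in x , x∈P , ~-sym p~x ∷ link

    -- Here `l` counts the vertices still to be added. The first extension that breaks robustness
    -- supplies a fragment, from which `descend` produces the whole path.
    grow : ∀ l {j} (P : Path G j) → l + j ≡ m → Robust G k (remaining P) → KeepingPath
    grow zero P refl ρ = P , ρ
    grow (suc l) {j} P 1+l+j≡m ρ = let x , x∈P , link = next P j<m ρ in step x∈P link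
      where
      j<m : j < m
      j<m = ≤-trans (s≤s (m≤n+m j l)) (≤-reflexive 1+l+j≡m)

      step : ∀ {x} → x ∈ remaining P → Linked _~_ (x ∷ Path.vertices P) → KeepingPath
      step x∈P link with extend? P x∈P link j<m
      ... | inj₁ ρ⁺              = grow l (extend P x∈P link) (trans (+-suc l j) 1+l+j≡m) ρ⁺
      ... | inj₂ (_ , _ , φ , _) = descend P j<m ρ φ (<-wellFounded _)

    keepingPath : Robust G k (V G) → KeepingPath
    keepingPath ρ = grow m empty (+-identityʳ m) (subst (Robust G k) (sym (p─⊥≡p (V G))) ρ)
      where
      empty : Path G 0
      empty = record { vertices = [] ; inside = [] ; distinct = [] ; linked = [] }

-- Passes from a vertex set inside `G` to the graph with `U` deleted, where `KConnected` is stated.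
robust-∖ : ∀ {N k} {G : Graph N} {U} → Robust G k (V (G ∖ U)) → Robust (G ∖ U) k (V (G ∖ U))
robust-∖ {G = G} {U} ρ = record
  { order>k = order>k ρ ; boundary≥k = λ σ → boundary≥k ρ (undelete {G = G} {U} id id σ) }

theorem3p2 : ∀ (k m : ℕ) → 1 ≤ k → 1 ≤ m →
    ∀ {N : ℕ} (G : Graph N) →
    KConnected k G → Bipartite G → MinDegree≥ G (k + m) →
    ∃ λ (P : Path G m) → KConnected k (G ∖ vertexSet P)
theorem3p2 k m 1≤k _ G κ≥k bipartite δ≥ =
  let P , ρ = keepingPath 1≤k (MinDegree≥⇒degree≥ {G = G} δ≥) (bipartite⇒triangleFree {G = G} bipartite)
                (KConnected⇒robust κ≥k)
  in P , robust⇒KConnected (robust-∖ ρ)
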